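{- For every integer $q\ge2$, $\gamma^{DLD}(K_q^3)=q^2$.
   Context: $K_q^3=K_q\square K_q\square K_q$ is the graph with vertex set $\{1,\dots,q\}^3$ in which two vertices are adjacent iff they differ in exactly one coordinate. For a code (nonempty vertex subset) $C$ and vertex $v$, $I(C;v)=N[v]\cap C$, where $N[v]$ is the closed neighbourhood. A code $C$ is solid-locating-dominating if for all distinct non-codewords $u,v$, $I(C;u)\setminus I(C;v)\ne\emptyset$. $\gamma^{DLD}(G)$ is the minimum size of a solid-locating-dominating code in the finite graph $G$. -}

module Defs where

open import Data.Fin.Base using (Fin)
open import Data.Fin.Properties using (*↔×)
open import Data.List.Base using (List; []; length)
open import Data.List.Membership.Propositional using () renaming (_∈_ to _∈ˡ_)
open import Data.List.Relation.Unary.Unique.Propositional using (Unique)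
open import Data.Nat.Base using (ℕ; _*_; _≤_)
open import Data.Nat.Properties using (≤-antisym)
open import Data.Product.Base using (_×_; _,_; ∃-syntax)
open import Data.Product.Function.NonDependent.Propositional using (_×-↔_)
open import Data.Sum.Base using (_⊎_; inj₁; inj₂)
open import Function.Bundles using (_↔_; _⇔_; mk⇔)
open import Function.Construct.Composition using (_↔-∘_)
open import Function.Construct.Identity using (↔-id)
open import Function.Construct.Symmetry using (↔-sym)
open import Level using (0ℓ)
open import Relation.Binary.Core using (Rel)
open import Relation.Binary.Definitions using (Symmetric)
open import Relation.Binary.PropositionalEquality
  using (_≡_; _≢_; refl; sym; ≢-sym)
open import Relation.Nullary.Negation using (¬_)
open import Relation.Unary using (Pred; _∉_; _∩_; _∖_; Satisfiable)

record FiniteGraph : Set₁ where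
  infix 4 _~_
  field
    Vertex      : Set
    _~_         : Rel Vertex 0ℓ
    ~-sym       : Symmetric _~_
    ~-irrefl    : ∀ {v} → ¬ (v ~ v)
    order       : ℕ
    enumeration : Vertex ↔ Fin order

  N[_] : Vertex → Pred Vertex 0ℓ
  N[ v ] u = u ≡ v ⊎ v ~ u

K : ℕ → FiniteGraph
K n = record
  { Vertex      = Fin n
  ; _~_         = _≢_
  ; ~-sym       = ≢-sym
  ; ~-irrefl    = λ v≢v → v≢v refl
  ; order       = n
  ; enumeration = ↔-id (Fin n)
  }

infixr 6 _□_

_□_ : FiniteGraph → FiniteGraph → FiniteGraph
G □ H = record
  { Vertex      = G.Vertex × H.Vertex
  ; _~_         = λ (g , h) (g′ , h′) → (g ≡ g′ × h H.~ h′) ⊎ (g G.~ g′ × h ≡ h′)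
  ; ~-sym       = λ { (inj₁ (e , a)) → inj₁ (sym e , H.~-sym a)
                    ; (inj₂ (a , e)) → inj₂ (G.~-sym a , sym e) }
  ; ~-irrefl    = λ { (inj₁ (_ , a)) → H.~-irrefl a
                    ; (inj₂ (a , _)) → G.~-irrefl a }
  ; order       = G.order * H.order
  ; enumeration = ↔-sym *↔× ↔-∘ (G.enumeration ×-↔ H.enumeration)
  }
  where
  module G = FiniteGraph G
  module H = FiniteGraph H

K³ : ℕ → FiniteGraph
K³ q = K q □ K q □ K q

-- Adjacency in K³ q is differing in exactly one coordinate.
K³-adjacent : ∀ {q} (x y z x′ y′ z′ : Fin q) →
  FiniteGraph._~_ (K³ q) (x , y , z) (x′ , y′ , z′) ⇔
    ( (x ≢ x′ × y ≡ y′ × z ≡ z′)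
    ⊎ (x ≡ x′ × y ≢ y′ × z ≡ z′)
    ⊎ (x ≡ x′ × y ≡ y′ × z ≢ z′))
K³-adjacent x y z x′ y′ z′ = mk⇔
  (λ { (inj₁ (p , inj₁ (r , s))) → inj₂ (inj₂ (p , r , s))
     ; (inj₁ (p , inj₂ (r , s))) → inj₂ (inj₁ (p , r , s))
     ; (inj₂ (p , refl))         → inj₁ (p , refl , refl) })
  (λ { (inj₁ (p , refl , refl))    → inj₂ (p , refl)
     ; (inj₂ (inj₁ (p , r , s)))   → inj₁ (p , inj₂ (r , s))
     ; (inj₂ (inj₂ (p , r , s)))   → inj₁ (p , inj₁ (r , s)) })

module _ (G : FiniteGraph) where
  open FiniteGraph G

  -- A nonempty vertex subset, listed without repetition, so that its
  -- cardinality is the length of the list.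
  record Code : Set where
    field
      codewords : List Vertex
      unique    : Unique codewords
      nonempty  : codewords ≢ []

    Codeword : Pred Vertex 0ℓ
    Codeword v = v ∈ˡ codewords

    size : ℕ
    size = length codewords

  open Code

  I : Code → Vertex → Pred Vertex 0ℓ
  I C v = N[ v ] ∩ Codeword C

  SolidLocatingDominating : Pred Code 0ℓ
  SolidLocatingDominating C =
    ∀ u v → u ∉ Codeword C → v ∉ Codeword C → u ≢ v → Satisfiable (I C u ∖ I C v)

  -- k is the minimum size of a solid-locating-dominating code, i.e. γᴰᴸᴰ(G) = k.
  Isγᴰᴸᴰ : Pred ℕ 0ℓ
  Isγᴰᴸᴰ k =
    (∃[ C ] SolidLocatingDominating C × size C ≡ k) ×
    (∀ C → SolidLocatingDominating C → k ≤ size C)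

  Isγᴰᴸᴰ-unique : ∀ {k l} → Isγᴰᴸᴰ k → Isγᴰᴸᴰ l → k ≡ l
  Isγᴰᴸᴰ-unique ((C , C-sld , refl) , k-min) ((D , D-sld , refl) , l-min) =
    ≤-antisym (k-min D D-sld) (l-min C C-sld)

{-# OPTIONS --safe #-}

-- The Latin square code z = x + y (mod q) is optimal. For the lower bound
-- choose, among the layers in all three directions, one with fewest
-- codewords, k say; only k < q is of interest. A pillar, that is a line
-- orthogonal to the layer, is full up to its foot if both its row and its
-- column in the layer are empty, and nonempty if only its row is empty,
-- unless its column then has q − 1 codewords. For q > 2, exchanging rows and
-- columns rules out the exception. With a empty rows and b empty columns (a,
-- b ≥ q − k), the layers through the empty rows have at least q + b (q − 2)
-- codewords and the other layers parallel to them at least k, which gives q²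
-- unless k = q − 1 and a = b = 1. In that case the layer is a partial
-- permutation matrix with q − 1 entries, and every pillar is nonempty.
module Submission where

open import Data.Bool.Base using (Bool; true; false; if_then_else_; _∨_)
open import Data.Fin.Base using (Fin; zero; suc; toℕ; punchIn; punchOut)
open import Data.Fin.Properties
  using (any?; all?; ¬∀⟶∃¬; punchInᵢ≢i; punchIn-punchOut; toℕ-injective; toℕ-fromℕ<; toℕ<n)
  renaming (_≟_ to _≟ᶠ_)
open import Data.List.Base using (List; []; _∷_; length; map; allFin; cartesianProductWith)
open import Data.List.Properties using (length-++; length-map; length-tabulate)
open import Data.List.Membership.Propositional.Properties using (∈-cartesianProductWith⁺; ∈-allFin)
open import Data.List.Relation.Unary.Unique.Propositional.Properties using (cartesianProductWith⁺; allFin⁺)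
open import Data.Nat.Base
open import Data.Nat.DivMod using (_mod_; %-distribˡ-+; m%n%n≡m%n; [m+n]%n≡m%n; m<n⇒m%n≡m)
open import Data.Nat.Properties
open import Data.Nat.Tactic.RingSolver using (solve-∀)
open import Data.Product.Base using (_×_; _,_; proj₁; proj₂; ∃-syntax)
open import Data.Product.Properties using (≡-dec; ,-injectiveˡ; ,-injectiveʳ)
open import Data.Sum.Base as Sum using (_⊎_; inj₁; inj₂)
open import Defs
open import Function.Base using (_∘_; id)
open import Relation.Binary.Definitions using (DecidableEquality)
open import Relation.Binary.PropositionalEquality
open import Relation.Nullary using (yes; no; contradiction; ¬_; does)
open import Relation.Nullary.Decidable using (decidable-stable; ¬?)
open import Algebra.Properties.Semiring.Sum +-*-semiring
  using (sum; sum-syntax; sum-remove; ∑-distrib-+; ∑-comm; sum-cong-≗; *-distribʳ-sum)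

open FiniteGraph using (Vertex; N[_])

private variable
  q n : ℕ

-- Closed neighbourhoods in coordinates

-- Lying on a common axis-parallel line. Nothing is said about the third coordinate, so equality and
-- adjacency need not be told apart.
Near : (p r s a b c : Fin q) → Set
Near p r s a b c = (r ≡ b × s ≡ c) ⊎ (p ≡ a × s ≡ c) ⊎ (p ≡ a × r ≡ b)

N⇒Near : ∀ {p r s a b c : Fin q} → N[_] (K³ q) (p , r , s) (a , b , c) → Near p r s a b c
N⇒Near (inj₁ refl)                            = inj₁ (refl , refl)
N⇒Near (inj₂ (inj₁ (p≡a , inj₁ (r≡b , _)))) = inj₂ (inj₂ (p≡a , r≡b))
N⇒Near (inj₂ (inj₁ (p≡a , inj₂ (_ , s≡c)))) = inj₂ (inj₁ (p≡a , s≡c))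
N⇒Near (inj₂ (inj₂ (_ , refl)))              = inj₁ (refl , refl)

Near⇒N : ∀ {p r s a b c : Fin q} → Near p r s a b c → N[_] (K³ q) (p , r , s) (a , b , c)
Near⇒N {p = p} {a = a} (inj₁ (refl , refl)) with p ≟ᶠ a
... | yes refl = inj₁ refl
... | no p≢a   = inj₂ (inj₂ (p≢a , refl))
Near⇒N {r = r} {b = b} (inj₂ (inj₁ (refl , refl))) with r ≟ᶠ b
... | yes refl = inj₁ refl
... | no r≢b   = inj₂ (inj₁ (refl , inj₂ (r≢b , refl)))
Near⇒N {s = s} {c = c} (inj₂ (inj₂ (refl , refl))) with s ≟ᶠ c
... | yes refl = inj₁ refl
... | no s≢c   = inj₂ (inj₁ (refl , inj₁ (refl , s≢c)))

-- The upper bound: the Latin square code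

length-cartesianProductWith : ∀ {A B C : Set} (f : A → B → C) xs ys →
  length (cartesianProductWith f xs ys) ≡ length xs * length ys
length-cartesianProductWith f []       ys = refl
length-cartesianProductWith f (x ∷ xs) ys =
  trans (length-++ (map (f x) ys))
        (cong₂ _+_ (length-map (f x) ys) (length-cartesianProductWith f xs ys))

module _ {n : ℕ} where

  -- A negative is represented by its complement to `suc n`, which truncated subtraction computes
  -- exactly because `toℕ x < suc n`.
  _⊕_ _⊖_ : Fin (suc n) → Fin (suc n) → Fin (suc n)
  x ⊕ y = (toℕ x + toℕ y) mod suc n
  z ⊖ x = (toℕ z + (suc n ∸ toℕ x)) mod suc n

  ⊕-comm : ∀ x y → x ⊕ y ≡ y ⊕ x
  ⊕-comm x y = cong (_mod suc n) (+-comm (toℕ x) (toℕ y))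

  ⊕-⊖ : ∀ x z → x ⊕ (z ⊖ x) ≡ z
  ⊕-⊖ x z = toℕ-injective (begin
    toℕ (x ⊕ (z ⊖ x))                    ≡⟨ toℕ-fromℕ< _ ⟩
    (i + toℕ (z ⊖ x)) % suc n                ≡⟨ cong (λ d → (i + d) % suc n) (toℕ-fromℕ< _) ⟩
    (i + (k + (suc n ∸ i)) % suc n) % suc n          ≡⟨ %-distribˡ-+ i _ (suc n) ⟩
    (i % suc n + (k + (suc n ∸ i)) % suc n % suc n) % suc n  ≡⟨ cong (λ d → (i % suc n + d) % suc n) (m%n%n≡m%n (k + (suc n ∸ i)) (suc n)) ⟩
    (i % suc n + (k + (suc n ∸ i)) % suc n) % suc n      ≡⟨ %-distribˡ-+ i _ (suc n) ⟨
    (i + (k + (suc n ∸ i))) % suc n              ≡⟨ cong (_% suc n) (+-comm i _) ⟩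
    (k + (suc n ∸ i) + i) % suc n                ≡⟨ cong (_% suc n) (+-assoc k _ i) ⟩
    (k + ((suc n ∸ i) + i)) % suc n              ≡⟨ cong (λ d → (k + d) % suc n) (m∸n+n≡m (<⇒≤ (toℕ<n x))) ⟩
    (k + suc n) % suc n                          ≡⟨ [m+n]%n≡m%n k (suc n) ⟩
    k % suc n                                ≡⟨ m<n⇒m%n≡m (toℕ<n z) ⟩
    k                                    ∎)
    where
    open ≡-Reasoning
    i = toℕ x
    k = toℕ z

  ⊖-⊕ : ∀ y z → (z ⊖ y) ⊕ y ≡ z
  ⊖-⊕ y z = trans (⊕-comm (z ⊖ y) y) (⊕-⊖ y z)

  latinPoint : (x y : Fin (suc n)) → Vertex (K³ (suc n))
  latinPoint x y = x , y , x ⊕ y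

  latinCode : Code (K³ (suc n))
  latinCode = record
    { codewords = cartesianProductWith latinPoint (allFin (suc n)) (allFin (suc n))
    ; unique    = cartesianProductWith⁺ latinPoint
                    (λ eq → ,-injectiveˡ eq , ,-injectiveˡ (,-injectiveʳ eq))
                    (allFin⁺ _) (allFin⁺ _)
    ; nonempty  = λ ()
    }

  open Code latinCode using (Codeword; size)

  latinCode-size : size ≡ suc n ^ 2
  latinCode-size = begin
    size                                              ≡⟨ length-cartesianProductWith latinPoint (allFin (suc n)) (allFin (suc n)) ⟩
    length (allFin (suc n)) * length (allFin (suc n)) ≡⟨ cong₂ _*_ length-allFin (trans length-allFin (sym (*-identityʳ _))) ⟩
    suc n ^ 2                                         ∎
    where
    open ≡-Reasoning
    length-allFin : length (allFin (suc n)) ≡ suc n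
    length-allFin = length-tabulate id

  latin-codeword : ∀ {x y z} → x ⊕ y ≡ z → Codeword (x , y , z)
  latin-codeword {x} {y} refl = ∈-cartesianProductWith⁺ latinPoint (∈-allFin x) (∈-allFin y)

  -- Every axis-parallel line has exactly one codeword, so each of the three lines through the first
  -- point carries a codeword other than that point. The line is chosen such that this codeword
  -- differs from the second point in two coordinates.
  latinCode-solid : SolidLocatingDominating (K³ (suc n)) latinCode
  latinCode-solid (x , y , z) (p , r , s) u∉C v∉C u≢v with p ≟ᶠ x | r ≟ᶠ y
  ... | yes refl | yes refl =
    (x , z ⊖ x , z) , (Near⇒N (inj₂ (inj₁ (refl , refl))) , latin-codeword (⊕-⊖ x z)) ,
    λ (near , _) → far (N⇒Near near)
    where
    far : ¬ Near x y s x (z ⊖ x) z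
    far (inj₁ (_ , refl))             = u≢v refl
    far (inj₂ (inj₁ (_ , refl)))      = u≢v refl
    far (inj₂ (inj₂ (_ , y≡z⊖x)))     = u∉C (latin-codeword (trans (cong (x ⊕_) y≡z⊖x) (⊕-⊖ x z)))
  ... | no p≢x | yes refl =
    (x , z ⊖ x , z) , (Near⇒N (inj₂ (inj₁ (refl , refl))) , latin-codeword (⊕-⊖ x z)) ,
    λ (near , _) → far (N⇒Near near)
    where
    far : ¬ Near p y s x (z ⊖ x) z
    far (inj₁ (y≡z⊖x , _))            = u∉C (latin-codeword (trans (cong (x ⊕_) y≡z⊖x) (⊕-⊖ x z)))
    far (inj₂ (inj₁ (p≡x , _)))       = p≢x p≡x
    far (inj₂ (inj₂ (p≡x , _)))       = p≢x p≡x
  ... | yes refl | no r≢y =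
    (z ⊖ y , y , z) , (Near⇒N (inj₁ (refl , refl)) , latin-codeword (⊖-⊕ y z)) ,
    λ (near , _) → far (N⇒Near near)
    where
    x≢z⊖y : x ≢ z ⊖ y
    x≢z⊖y x≡z⊖y = u∉C (latin-codeword (trans (cong (_⊕ y) x≡z⊖y) (⊖-⊕ y z)))
    far : ¬ Near x r s (z ⊖ y) y z
    far (inj₁ (r≡y , _))              = r≢y r≡y
    far (inj₂ (inj₁ (x≡z⊖y , _)))     = x≢z⊖y x≡z⊖y
    far (inj₂ (inj₂ (_ , r≡y)))       = r≢y r≡y
  ... | no p≢x | no r≢y =
    (x , y , x ⊕ y) , (Near⇒N (inj₂ (inj₂ (refl , refl))) , latin-codeword refl) ,
    λ (near , _) → far (N⇒Near near)
    where
    far : ¬ Near p r s x y (x ⊕ y)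
    far (inj₁ (r≡y , _))              = r≢y r≡y
    far (inj₂ (inj₁ (p≡x , _)))       = p≢x p≡x
    far (inj₂ (inj₂ (p≡x , _)))       = p≢x p≡x

-- Finite sums of natural numbers

∑-mono : {f g : Fin n → ℕ} → (∀ i → f i ≤ g i) → sum f ≤ sum g
∑-mono {zero}  f≤g = z≤n
∑-mono {suc n} f≤g = +-mono-≤ (f≤g zero) (∑-mono (f≤g ∘ suc))

∑-const : ∀ n c → ∑[ i < n ] c ≡ n * c
∑-const zero    c = refl
∑-const (suc n) c = cong (c +_) (∑-const n c)

∑-one : ∀ n → ∑[ i < n ] 1 ≡ n
∑-one n = trans (∑-const n 1) (*-identityʳ n)

-- The terms at `i` are dropped from both sums; each is moved to the other side, which avoids
-- truncated subtraction.
∑-mono-except : {f g : Fin n → ℕ} (i : Fin n) → (∀ j → j ≢ i → f j ≤ g j) →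
                g i + sum f ≤ sum g + f i
∑-mono-except {n = suc _} {f} {g} i f≤g = begin
  g i + sum f         ≡⟨ cong (g i +_) (sum-remove {i = i} f) ⟩
  g i + (f i + sum f′) ≤⟨ +-monoʳ-≤ (g i) (+-monoʳ-≤ (f i) (∑-mono λ j → f≤g _ (punchInᵢ≢i i j))) ⟩
  g i + (f i + sum g′) ≡⟨ rearrange (g i) (f i) (sum g′) ⟩
  g i + sum g′ + f i   ≡⟨ cong (_+ f i) (sum-remove {i = i} g) ⟨
  sum g + f i          ∎
  where
  open ≤-Reasoning
  f′ = f ∘ punchIn i
  g′ = g ∘ punchIn i
  rearrange : ∀ x y z → x + (y + z) ≡ x + z + y
  rearrange = solve-∀

term≤∑ : (f : Fin n → ℕ) (i : Fin n) → f i ≤ sum f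
term≤∑ {suc _} f i = subst (f i ≤_) (sym (sum-remove {i = i} f)) (m≤m+n (f i) _)

two-terms≤∑ : (f : Fin n → ℕ) {i j : Fin n} → i ≢ j → f i + f j ≤ sum f
two-terms≤∑ {suc _} f {i} {j} i≢j = begin
  f i + f j                                ≡⟨ cong (λ l → f i + f l) (punchIn-punchOut i≢j) ⟨
  f i + f (punchIn i (punchOut i≢j))       ≤⟨ +-monoʳ-≤ (f i) (term≤∑ (f ∘ punchIn i) (punchOut i≢j)) ⟩
  f i + sum (f ∘ punchIn i)                ≡⟨ sum-remove {i = i} f ⟨
  sum f                                    ∎
  where open ≤-Reasoning

∑≡0⇒≡0 : (f : Fin n → ℕ) → sum f ≡ 0 → ∀ i → f i ≡ 0
∑≡0⇒≡0 f ∑f≡0 i = n≤0⇒n≡0 (subst (f i ≤_) ∑f≡0 (term≤∑ f i))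

∑-zero : (f : Fin n → ℕ) → (∀ i → f i ≡ 0) → sum f ≡ 0
∑-zero {n} f f≡0 = trans (sum-cong-≗ f≡0) (trans (∑-const n 0) (*-zeroʳ n))

∑-affine : (f g : Fin n → ℕ) (c : ℕ) → ∑[ i < n ] (f i + g i * c) ≡ sum f + sum g * c
∑-affine f g c = trans (∑-distrib-+ f (λ i → g i * c)) (cong (sum f +_) (sym (*-distribʳ-sum c g)))

∑-single≤ : (f : Fin n → ℕ) (i : Fin n) → (∀ j → j ≢ i → f j ≡ 0) → sum f ≤ f i
∑-single≤ {n} f i f≡0 = subst (sum f ≤_) (cong (_+ f i) (trans (∑-const n 0) (*-zeroʳ n)))
  (∑-mono-except {g = λ _ → 0} i λ j j≢i → ≤-reflexive (f≡0 j j≢i))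

other : (i : Fin (2 + n)) → ∃[ j ] j ≢ i
other i = punchIn i zero , punchInᵢ≢i i zero

sole-support : (f : Fin (2 + n) → ℕ) (i : Fin (2 + n)) → sum f ≤ 1 → f i ≡ 0 →
               ∃[ j ] j ≢ i × (∀ l → f l ≢ 0 → l ≡ j)
sole-support f i ∑f≤1 fi≡0 with any? (λ j → ¬? (f j ≟ 0))
... | yes (j , fj≢0) = j , (λ { refl → fj≢0 fi≡0 }) , unique
  where
  unique : ∀ l → f l ≢ 0 → l ≡ j
  unique l fl≢0 with l ≟ᶠ j
  ... | yes l≡j = l≡j
  ... | no l≢j  = contradiction
    (≤-trans (+-mono-≤ (n≢0⇒n>0 fl≢0) (n≢0⇒n>0 fj≢0)) (≤-trans (two-terms≤∑ f l≢j) ∑f≤1))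
    λ { (s≤s ()) }
-- Without support any index other than `i` will do; one exists since there are at least two
-- indices.
... | no none = let j , j≢i = other i in
  j , j≢i , λ l fl≢0 → contradiction (l , fl≢0) none

argmin : (f : Fin (suc n) → ℕ) → ∃[ i ] ∀ j → f i ≤ f j
argmin {zero}  f = zero , λ { zero → ≤-refl }
argmin {suc n} f with argmin (f ∘ suc)
... | i , least with ≤-total (f zero) (f (suc i))
... | inj₁ ≤i = zero , λ { zero → ≤-refl ; (suc j) → ≤-trans ≤i (least j) }
... | inj₂ i≤ = suc i , λ { zero → i≤ ; (suc j) → least j }

-- Cubes, their layers and their symmetries

Cube : ℕ → Set
Cube q = Fin q → Fin q → Fin q → ℕ

layer : Cube q → Fin q → ℕ
layer {q} f x = ∑[ y < q ] ∑[ z < q ] f x y z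

total : Cube q → ℕ
total f = sum (layer f)

-- The layers of `f`, `rot f` and `rot (rot f)` are those with fixed first, second and third
-- coordinate of the original cube.
rot : Cube q → Cube q
rot f y z x = f x y z

-- Keeps each layer with fixed first coordinate but exchanges its rows and columns.
transpose : Cube q → Cube q
transpose f x z y = f x y z

layer-transpose : (f : Cube q) (x : Fin q) → layer (transpose f) x ≡ layer f x
layer-transpose f x = ∑-comm (λ z y → f x y z)

layer-rot-transpose : (f : Cube q) (z : Fin q) → layer (rot (transpose f)) z ≡ layer (rot (rot f)) z
layer-rot-transpose f z = ∑-comm (λ y x → f x y z)

total-transpose : (f : Cube q) → total (transpose f) ≡ total f
total-transpose f = sum-cong-≗ (layer-transpose f)

total-rot : (f : Cube q) → total (rot f) ≡ total f
total-rot {q} f = begin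
  ∑[ y < q ] ∑[ z < q ] ∑[ x < q ] f x y z  ≡⟨ sum-cong-≗ (λ y → ∑-comm (λ z x → f x y z)) ⟩
  ∑[ y < q ] ∑[ x < q ] ∑[ z < q ] f x y z  ≡⟨ ∑-comm (λ y x → ∑[ z < q ] f x y z) ⟩
  ∑[ x < q ] ∑[ y < q ] ∑[ z < q ] f x y z  ∎
  where open ≡-Reasoning

-- The codewords are the points with f ≢ 0. The condition is the
-- contrapositive of solid-location: I(u) ⊆ I(v) forces u = v for
-- non-codewords u and v, with I(u) split into the three lines through u.
record Separating (f : Cube q) : Set where
  field
    bounded   : ∀ x y z → f x y z ≤ 1
    separated : ∀ {x y z p r s} → f x y z ≡ 0 → f p r s ≡ 0 →
                (∀ a → f a y z ≢ 0 → Near p r s a y z) →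
                (∀ b → f x b z ≢ 0 → Near p r s x b z) →
                (∀ c → f x y c ≢ 0 → Near p r s x y c) →
                p ≡ x × r ≡ y × s ≡ z

Near-rot : ∀ {p r s a b c : Fin q} → Near r s p b c a → Near p r s a b c
Near-rot (inj₁ (s≡c , p≡a))        = inj₂ (inj₁ (p≡a , s≡c))
Near-rot (inj₂ (inj₁ (r≡b , p≡a))) = inj₂ (inj₂ (p≡a , r≡b))
Near-rot (inj₂ (inj₂ e))           = inj₁ e

Near-rot⁻ : ∀ {p r s a b c : Fin q} → Near p r s a b c → Near r s p b c a
Near-rot⁻ = Near-rot ∘ Near-rot

Near-transpose : ∀ {p r s a b c : Fin q} → Near p r s a b c → Near p s r a c b
Near-transpose (inj₁ (e , e′)) = inj₁ (e′ , e)
Near-transpose (inj₂ e)        = inj₂ (Sum.swap e)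

rot-separating : {f : Cube q} → Separating f → Separating (rot f)
rot-separating sep = record
  { bounded   = λ y z x → bounded x y z
  ; separated = λ u∉ v∉ hy hz hx →
      let ex , ey , ez = separated u∉ v∉
            (λ a → Near-rot ∘ hx a) (λ b → Near-rot ∘ hy b) (λ c → Near-rot ∘ hz c)
      in ey , ez , ex
  }
  where open Separating sep

transpose-separating : {f : Cube q} → Separating f → Separating (transpose f)
transpose-separating sep = record
  { bounded   = λ x z y → bounded x y z
  ; separated = λ u∉ v∉ hx hz hy →
      let ex , ey , ez = separated u∉ v∉
            (λ a → Near-transpose ∘ hx a) (λ b → Near-transpose ∘ hy b) (λ c → Near-transpose ∘ hz c)
      in ex , ez , ey
  }
  where open Separating sep

-- Rows, columns and pillars of one layer

module Lines (f : Cube q) (x₀ : Fin q) where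
  row col : Fin q → ℕ
  row y = ∑[ z < q ] f x₀ y z
  col z = ∑[ y < q ] f x₀ y z

  pillar : Fin q → Fin q → ℕ
  pillar y z = ∑[ x < q ] f x y z

  -- 1 ∸ n is the indicator of n ≡ 0.
  emptyRows emptyCols : ℕ
  emptyRows = ∑[ y < q ] (1 ∸ row y)
  emptyCols = ∑[ z < q ] (1 ∸ col z)

  row+emptyRow : sum (λ y → row y + (1 ∸ row y)) ≡ layer f x₀ + emptyRows
  row+emptyRow = ∑-distrib-+ row _

  -- Each row has a codeword or counts as empty.
  q≤layer+emptyRows : q ≤ layer f x₀ + emptyRows
  q≤layer+emptyRows = subst₂ _≤_ (∑-one q) row+emptyRow (∑-mono λ y → m≤n+m∸n 1 (row y))

  -- Only the crossing point of the row and the column is counted twice.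
  row+col≤ : ∀ y z → row y + col z ≤ layer f x₀ + f x₀ y z
  row+col≤ y z = ∑-mono-except y λ y′ _ → term≤∑ (f x₀ y′) z

  emptyRows<q : 1 ≤ layer f x₀ → emptyRows < q
  emptyRows<q 1≤k with all? (λ y → row y ≟ 0)
  ... | yes row≡0 = contradiction 1≤k (<⇒≱ (s≤s (≤-reflexive (∑-zero row row≡0))))
  ... | no ¬row≡0 with ¬∀⟶∃¬ q (λ y → row y ≡ 0) (λ y → row y ≟ 0) ¬row≡0
  ... | y , row≢0 = begin
    1 + emptyRows                   ≤⟨ ∑-mono-except y (λ y′ _ → m∸n≤m 1 (row y′)) ⟩
    ∑[ i < q ] 1 + (1 ∸ row y)      ≡⟨ cong₂ _+_ (∑-one q) (m≤n⇒m∸n≡0 (n≢0⇒n>0 row≢0)) ⟩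
    q + 0                           ≡⟨ +-identityʳ q ⟩
    q                               ∎
    where open ≤-Reasoning

  -- The q summands `row y + (1 ∸ row y)` are each at least 1 and add up to at most q, so none
  -- exceeds 1.
  row≤1 : layer f x₀ + emptyRows ≤ q → ∀ y → row y ≤ 1
  row≤1 k+a≤q y = ≤-trans (m≤m+n (row y) _) (+-cancelʳ-≤ q _ 1 (begin
    row y + (1 ∸ row y) + q                      ≡⟨ cong (row y + (1 ∸ row y) +_) (∑-one q) ⟨
    row y + (1 ∸ row y) + ∑[ i < q ] 1           ≤⟨ ∑-mono-except y (λ y′ _ → m≤n+m∸n 1 (row y′)) ⟩
    sum (λ y → row y + (1 ∸ row y)) + 1          ≡⟨ cong (_+ 1) row+emptyRow ⟩
    layer f x₀ + emptyRows + 1                   ≤⟨ +-monoˡ-≤ 1 k+a≤q ⟩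
    q + 1                                        ≡⟨ +-comm q 1 ⟩
    1 + q                                        ∎))
    where open ≤-Reasoning

module SeparatingLines {f : Cube q} (sep : Separating f) (x₀ : Fin q) where
  open Separating sep
  open Lines f x₀ public

  -- The codewords near the foot all lie on the pillar, hence are near each of its points. By
  -- separation the foot is the only non-codeword there, which accounts for the `1`.
  pillar-full : ∀ {y z} → row y ≡ 0 → col z ≡ 0 → q ≤ 1 + pillar y z
  pillar-full {y} {z} row≡0 col≡0 = begin
    q                                            ≤⟨ m≤n+m q (f x₀ y z) ⟩
    f x₀ y z + q                                 ≡⟨ cong (f x₀ y z +_) (∑-one q) ⟨
    f x₀ y z + ∑[ i < q ] 1                      ≤⟨ ∑-mono-except {f = λ _ → 1} x₀ (λ x x≢x₀ → n≢0⇒n>0 (full x≢x₀)) ⟩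
    pillar y z + 1                               ≡⟨ +-comm (pillar y z) 1 ⟩
    1 + pillar y z                               ∎
    where
    open ≤-Reasoning
    row-0 : ∀ c → f x₀ y c ≡ 0
    row-0 = ∑≡0⇒≡0 _ row≡0
    col-0 : ∀ b → f x₀ b z ≡ 0
    col-0 = ∑≡0⇒≡0 _ col≡0
    full : ∀ {x} → x ≢ x₀ → f x y z ≢ 0
    full x≢x₀ fx≡0 = x≢x₀ (proj₁ (separated (row-0 z) fx≡0
      (λ a _ → inj₁ (refl , refl))
      (λ b fb≢0 → contradiction (col-0 b) fb≢0)
      (λ c fc≢0 → contradiction (row-0 c) fc≢0)))

  -- As for `pillar-full`, with the column as the only line through the foot that may contain
  -- codewords.
  col-full : ∀ {y z} → row y ≡ 0 → pillar y z ≡ 0 → q ≤ 1 + col z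
  col-full {y} {z} row≡0 pillar≡0 = begin
    q                                            ≤⟨ m≤n+m q (f x₀ y z) ⟩
    f x₀ y z + q                                 ≡⟨ cong (f x₀ y z +_) (∑-one q) ⟨
    f x₀ y z + ∑[ i < q ] 1                      ≤⟨ ∑-mono-except {f = λ _ → 1} y (λ b b≢y → n≢0⇒n>0 (full b≢y)) ⟩
    col z + 1                                    ≡⟨ +-comm (col z) 1 ⟩
    1 + col z                                    ∎
    where
    open ≤-Reasoning
    row-0 : ∀ c → f x₀ y c ≡ 0
    row-0 = ∑≡0⇒≡0 _ row≡0
    full : ∀ {b} → b ≢ y → f x₀ b z ≢ 0
    full b≢y fb≡0 = b≢y (proj₁ (proj₂ (separated (row-0 z) fb≡0
      (λ a fa≢0 → contradiction (∑≡0⇒≡0 (λ x → f x y z) pillar≡0 a) fa≢0)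
      (λ b _ → inj₂ (inj₁ (refl , refl)))
      (λ c fc≢0 → contradiction (row-0 c) fc≢0))))

module Bounds {m : ℕ} {f : Cube (2 + m)} (sep : Separating f) (x₀ : Fin (2 + m)) where
  open Separating sep
  open SeparatingLines sep x₀ public

  -- Here `m` is q - 2, so the bound is q - 1 over an empty column and 1 over any other. An empty
  -- pillar would need a column with q - 1 codewords, which `col≤m` excludes.
  pillar-over-emptyRow : (∀ z → col z ≤ m) → ∀ {y} → row y ≡ 0 → ∀ z →
                         1 + (1 ∸ col z) * m ≤ pillar y z
  pillar-over-emptyRow col≤m {y} row≡0 z with col z in col≡
  ... | zero  = s≤s⁻¹ (subst (_≤ 1 + pillar y z) (cong (2 +_) (sym (+-identityʳ m))) (pillar-full row≡0 col≡))
  ... | suc c = subst (_≤ pillar y z) (cong (1 +_) (cong (_* m) (sym (0∸n≡0 c)))) (n≢0⇒n>0 λ pillar≡0 →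
                  <⇒≱ (s≤s (s≤s (col≤m z))) (col-full row≡0 pillar≡0))

  -- The layers with fixed `y` partition the cube. One through an empty row consists of the pillars
  -- over that row and has at least q + b (q - 2) codewords; any other has at least k. The term
  -- `emptyRows * layer f x₀` on the right replaces a subtraction.
  layers-bound : (∀ z → col z ≤ m) → (∀ y → layer f x₀ ≤ layer (rot f) y) →
                 (2 + m) * layer f x₀ + emptyRows * (2 + m + emptyCols * m) ≤
                 total f + emptyRows * layer f x₀
  layers-bound col≤m k≤ = subst₂ _≤_ lhs rhs (∑-mono pointwise)
    where
    k = layer f x₀
    L = 2 + m + emptyCols * m

    ∑pillar : ∑[ z < 2 + m ] (1 + (1 ∸ col z) * m) ≡ L
    ∑pillar = trans (∑-affine (λ _ → 1) (λ z → 1 ∸ col z) m) (cong (_+ emptyCols * m) (∑-one (2 + m)))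

    pointwise : ∀ y → k + (1 ∸ row y) * L ≤ layer (rot f) y + (1 ∸ row y) * k
    pointwise y with row y in row≡
    ... | zero  = begin
      k + 1 * L                ≡⟨ cong (k +_) (*-identityˡ L) ⟩
      k + L                    ≡⟨ +-comm k L ⟩
      L + k                    ≤⟨ +-monoˡ-≤ k (subst (_≤ layer (rot f) y) ∑pillar (∑-mono (pillar-over-emptyRow col≤m row≡))) ⟩
      layer (rot f) y + k      ≡⟨ cong (layer (rot f) y +_) (*-identityˡ k) ⟨
      layer (rot f) y + 1 * k  ∎
      where open ≤-Reasoning
    ... | suc r rewrite 0∸n≡0 r = +-monoˡ-≤ 0 (k≤ y)

    lhs : ∑[ y < 2 + m ] (k + (1 ∸ row y) * L) ≡ (2 + m) * k + emptyRows * L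
    lhs = trans (∑-affine (λ _ → k) (λ y → 1 ∸ row y) L) (cong (_+ emptyRows * L) (∑-const (2 + m) k))

    rhs : ∑[ y < 2 + m ] (layer (rot f) y + (1 ∸ row y) * k) ≡ total f + emptyRows * k
    rhs = trans (∑-affine (layer (rot f)) (λ y → 1 ∸ row y) k) (cong (_+ emptyRows * k) (total-rot f))

  -- If the pillar is empty, I(x₀ , y , z) lies in {(x₀ , y , z₁) , (x₀ , y₁ , z)}
  -- with y₁ ≢ y and z₁ ≢ z. The opposite corner (x₀ , y₁ , z₁) is near both, hence
  -- a codeword, so neither of the two is one: the pillar over (y , z) is full.
  pillar-nonempty : (∀ y → row y ≤ 1) → (∀ z → col z ≤ 1) → ∀ y z → f x₀ y z ≡ 0 → pillar y z ≢ 0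
  pillar-nonempty row≤1 col≤1 y z fyz≡0 pillar≡0
    with sole-support (f x₀ y) z (row≤1 y) fyz≡0
       | sole-support (λ b → f x₀ b z) y (col≤1 z) fyz≡0
  ... | z₁ , z₁≢z , row-sole | y₁ , y₁≢y , col-sole = corner
    where
    corner≢0 : f x₀ y₁ z₁ ≢ 0
    corner≢0 f≡0 = y₁≢y (proj₁ (proj₂ (separated fyz≡0 f≡0
      (λ a fa≢0 → contradiction (∑≡0⇒≡0 (λ x → f x y z) pillar≡0 a) fa≢0)
      (λ b fb≢0 → inj₂ (inj₂ (refl , sym (col-sole b fb≢0))))
      (λ c fc≢0 → inj₂ (inj₁ (refl , sym (row-sole c fc≢0)))))))
    two : ∀ {s t u} → s ≢ 0 → t ≢ 0 → s + t ≤ u → ¬ u ≤ 1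
    two s≢0 t≢0 s+t≤u u≤1 = <⇒≱ (+-mono-≤ (n≢0⇒n>0 s≢0) (n≢0⇒n>0 t≢0)) (≤-trans s+t≤u u≤1)

    row-empty : ∀ c → f x₀ y c ≡ 0
    row-empty c = decidable-stable (_ ≟ 0) λ fc≢0 → two fc≢0
      (subst (λ c → f x₀ y₁ c ≢ 0) (sym (row-sole c fc≢0)) corner≢0)
      (two-terms≤∑ (λ b → f x₀ b c) (y₁≢y ∘ sym)) (col≤1 c)
    col-empty : ∀ b → f x₀ b z ≡ 0
    col-empty b = decidable-stable (_ ≟ 0) λ fb≢0 → two fb≢0
      (subst (λ b → f x₀ b z₁ ≢ 0) (sym (col-sole b fb≢0)) corner≢0)
      (two-terms≤∑ (f x₀ b) (z₁≢z ∘ sym)) (row≤1 b)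
    corner = <⇒≱ (s≤s (s≤s z≤n)) (subst (λ p → 2 + m ≤ 1 + p) pillar≡0 (pillar-full
      (∑-zero (f x₀ y) row-empty) (∑-zero (λ b → f x₀ b z) col-empty)))

-- Arithmetic of the layers bound

-- With t = q - k the bound says N ≥ q k + a (t + b m), while q² = q k + q t. What remains to be
-- shown is q t ≤ a (t + b m), the subject of the `slack` lemmas.
square≤-of-layers-bound : ∀ {q k t} a b {m N} → k + t ≡ q → q * t ≤ a * (t + b * m) →
  q * k + a * (q + b * m) ≤ N + a * k → q * q ≤ N
square≤-of-layers-bound {q} {k} {t} a b {m} {N} refl qt≤ bound = +-cancelʳ-≤ (a * k) _ _ (begin
  q * q + a * k                      ≡⟨ cong (_+ a * k) (*-distribˡ-+ q k t) ⟩
  q * k + q * t + a * k              ≤⟨ +-monoˡ-≤ (a * k) (+-monoʳ-≤ (q * k) qt≤) ⟩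
  q * k + a * (t + b * m) + a * k    ≡⟨ regroup (q * k) a k t (b * m) ⟩
  q * k + a * (q + b * m)            ≤⟨ bound ⟩
  N + a * k                          ∎)
  where
  open ≤-Reasoning
  regroup : ∀ u a k t c → u + a * (t + c) + a * k ≡ u + a * (k + t + c)
  regroup = solve-∀

2+m≤2+2m : ∀ m → 2 + m ≤ 2 + 2 * m
2+m≤2+2m m = +-monoʳ-≤ 2 (m≤m+n m _)

slack-roomy : ∀ {m t a b} → 2 ≤ t → t ≤ a → t ≤ b → (2 + m) * t ≤ a * (t + b * m)
slack-roomy {m} {t} {a} {b} 2≤t t≤a t≤b = begin
  (2 + m) * t      ≡⟨ *-comm (2 + m) t ⟩
  t * (2 + m)      ≤⟨ *-monoʳ-≤ t (2+m≤2+2m m) ⟩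
  t * (2 + 2 * m)  ≤⟨ *-mono-≤ t≤a (+-mono-≤ 2≤t (*-monoˡ-≤ m (≤-trans 2≤t t≤b))) ⟩
  a * (t + b * m)  ∎
  where open ≤-Reasoning

-- For t = 1 and a = b = 1 the right side would be 1 + m, one too small; hence one of the two counts
-- has to be at least 2.
slack-tightˡ : ∀ {m a b} → 2 ≤ a → 1 ≤ b → (2 + m) * 1 ≤ a * (1 + b * m)
slack-tightˡ {m} {a} {b} 2≤a 1≤b = begin
  (2 + m) * 1      ≡⟨ *-identityʳ (2 + m) ⟩
  2 + m            ≤⟨ 2+m≤2+2m m ⟩
  2 + 2 * m        ≡⟨ regroup m ⟩
  2 * (1 + 1 * m)  ≤⟨ *-mono-≤ 2≤a (+-monoʳ-≤ 1 (*-monoˡ-≤ m 1≤b)) ⟩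
  a * (1 + b * m)  ∎
  where
  open ≤-Reasoning
  regroup : ∀ m → 2 + 2 * m ≡ 2 * (1 + 1 * m)
  regroup = solve-∀

slack-tightʳ : ∀ {m a b} → 1 ≤ m → 1 ≤ a → 2 ≤ b → (2 + m) * 1 ≤ a * (1 + b * m)
slack-tightʳ {m} {a} {b} 1≤m 1≤a 2≤b = begin
  (2 + m) * 1      ≡⟨ regroup m ⟩
  1 + (1 + m)      ≤⟨ +-monoʳ-≤ 1 (+-monoˡ-≤ m 1≤m) ⟩
  1 + (m + m)      ≡⟨ regroup′ m ⟩
  1 * (1 + 2 * m)  ≤⟨ *-mono-≤ 1≤a (+-monoʳ-≤ 1 (*-monoˡ-≤ m 2≤b)) ⟩
  a * (1 + b * m)  ∎
  where
  open ≤-Reasoning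
  regroup : ∀ m → (2 + m) * 1 ≡ 1 + (1 + m)
  regroup = solve-∀
  regroup′ : ∀ m → 1 + (m + m) ≡ 1 * (1 + 2 * m)
  regroup′ = solve-∀

-- The lower bound for separating cubes

module SparseLayer {m : ℕ} {f : Cube (2 + m)} (sep : Separating f) (x₀ : Fin (2 + m))
  (k≤rot    : ∀ y → layer f x₀ ≤ layer (rot f) y)
  (k≤rotrot : ∀ z → layer f x₀ ≤ layer (rot (rot f)) z)
  where
  open Separating sep
  open Bounds sep x₀
  private
    -- `ᵀ.row` and `ᵀ.emptyRows` reduce to `col` and `emptyCols`, so each statement about rows is
    -- also available for columns.
    module ᵀ = Bounds (transpose-separating sep) x₀
    k = layer f x₀
    a = emptyRows
    b = emptyCols
    N = total f

    kᵀ≡k : layer (transpose f) x₀ ≡ k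
    kᵀ≡k = layer-transpose f x₀

  col≤k : ∀ z → col z ≤ k
  col≤k z = subst (col z ≤_) kᵀ≡k (term≤∑ col z)

  layers-boundᵀ : (∀ y → row y ≤ m) → (2 + m) * k + b * (2 + m + a * m) ≤ N + b * k
  layers-boundᵀ row≤m = subst₂ (λ k N → (2 + m) * k + b * (2 + m + a * m) ≤ N + b * k)
    kᵀ≡k (total-transpose f)
    (ᵀ.layers-bound row≤m λ z → subst₂ _≤_ (sym kᵀ≡k) (sym (layer-rot-transpose f z)) (k≤rotrot z))

  q≤k+b : 2 + m ≤ k + b
  q≤k+b = subst (λ k → 2 + m ≤ k + b) kᵀ≡k ᵀ.q≤layer+emptyRows

  -- Since k + a and k + b are at most q, no row or column has two codewords. Then each of the q²
  -- pillars, which partition the cube, has a codeword.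
  square≤-permutation : k + 1 ≡ 2 + m → a ≤ 1 → b ≤ 1 → (2 + m) * (2 + m) ≤ N
  square≤-permutation k+1≡q a≤1 b≤1 = subst₂ _≤_ ∑∑1 (total-rot f)
    (∑-mono λ y → ∑-mono λ z → n≢0⇒n>0 (pillar≢0 y z))
    where
    ∑∑1 : ∑[ y < 2 + m ] ∑[ z < 2 + m ] 1 ≡ (2 + m) * (2 + m)
    ∑∑1 = trans (sum-cong-≗ {2 + m} (λ _ → ∑-one (2 + m))) (∑-const (2 + m) (2 + m))

    rows≤1 : ∀ y → row y ≤ 1
    rows≤1 = row≤1 (≤-trans (+-monoʳ-≤ k a≤1) (≤-reflexive k+1≡q))
    cols≤1 : ∀ z → col z ≤ 1
    cols≤1 = ᵀ.row≤1 (subst (λ k → k + b ≤ 2 + m) (sym kᵀ≡k)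
                       (≤-trans (+-monoʳ-≤ k b≤1) (≤-reflexive k+1≡q)))

    pillar≢0 : ∀ y z → pillar y z ≢ 0
    pillar≢0 y z pillar≡0 =
      pillar-nonempty rows≤1 cols≤1 y z (∑≡0⇒≡0 (λ x → f x y z) pillar≡0 x₀) pillar≡0

  -- The layers bound applies unless some column has more than m codewords, its transpose unless
  -- some row has. If both occur, the row and the column together give 2 (1 + m) ≤ k + 1 = 2 + m,
  -- against m ≥ 1.
  square≤-tight : k + 1 ≡ 2 + m → 1 ≤ m →
    (2 + m) * 1 ≤ a * (1 + b * m) → (2 + m) * 1 ≤ b * (1 + a * m) → (2 + m) * (2 + m) ≤ N
  square≤-tight k+1≡q 1≤m slack slackᵀ with all? (λ z → col z ≤? m) | all? (λ y → row y ≤? m)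
  ... | yes col≤m | _         = square≤-of-layers-bound a b k+1≡q slack (layers-bound col≤m k≤rot)
  ... | no _      | yes row≤m = square≤-of-layers-bound b a k+1≡q slackᵀ (layers-boundᵀ row≤m)
  ... | no ¬col≤m | no ¬row≤m
    with ¬∀⟶∃¬ _ (λ z → col z ≤ m) (λ z → col z ≤? m) ¬col≤m
       | ¬∀⟶∃¬ _ (λ y → row y ≤ m) (λ y → row y ≤? m) ¬row≤m
  ... | z , col≰m | y , row≰m = contradiction (begin
    1 + m + (1 + m)      ≤⟨ +-mono-≤ (≰⇒> row≰m) (≰⇒> col≰m) ⟩
    row y + col z        ≤⟨ row+col≤ y z ⟩
    k + f x₀ y z         ≤⟨ +-monoʳ-≤ k (bounded x₀ y z) ⟩
    k + 1                ≡⟨ k+1≡q ⟩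
    2 + m                ≡⟨ +-comm 1 (1 + m) ⟩
    1 + m + 1            ∎)
    (<⇒≱ (+-monoʳ-< (1 + m) (s≤s 1≤m)))
    where open ≤-Reasoning

  square≤ : k < 2 + m → (2 + m) * (2 + m) ≤ N
  square≤ k<q = go (2 + m ∸ k) (m+[n∸m]≡n (<⇒≤ k<q))
    where
    open ≤-Reasoning
    t≤a : ∀ {t} → k + t ≡ 2 + m → t ≤ a
    t≤a k+t≡q = +-cancelˡ-≤ k _ _ (≤-trans (≤-reflexive k+t≡q) q≤layer+emptyRows)
    t≤b : ∀ {t} → k + t ≡ 2 + m → t ≤ b
    t≤b k+t≡q = +-cancelˡ-≤ k _ _ (≤-trans (≤-reflexive k+t≡q) q≤k+b)

    k≡1+m : k + 1 ≡ 2 + m → k ≡ 1 + m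
    k≡1+m k+1≡q = suc-injective (trans (+-comm 1 k) k+1≡q)

    1≤k : k + 1 ≡ 2 + m → 1 ≤ k
    1≤k k+1≡q = subst (1 ≤_) (sym (k≡1+m k+1≡q)) (s≤s z≤n)

    go : ∀ t → k + t ≡ 2 + m → (2 + m) * (2 + m) ≤ N
    go 0 k+0≡q = contradiction (trans (sym (+-identityʳ k)) k+0≡q) (<⇒≢ k<q)
    -- Now k ≤ q - 2, so no column can have q - 1 codewords.
    go (suc (suc t)) k+t≡q = square≤-of-layers-bound a b k+t≡q
      (slack-roomy (s≤s (s≤s z≤n)) (t≤a k+t≡q) (t≤b k+t≡q))
      (layers-bound (λ z → ≤-trans (col≤k z) k≤m) k≤rot)
      where
      k≤m : k ≤ m
      k≤m = +-cancelʳ-≤ 2 k m (begin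
        k + 2        ≤⟨ +-monoʳ-≤ k (s≤s (s≤s z≤n)) ⟩
        k + (2 + t)  ≡⟨ k+t≡q ⟩
        2 + m        ≡⟨ +-comm 2 m ⟩
        m + 2        ∎)
    go 1 k+1≡q with a ≤? 1 | b ≤? 1
    ... | yes a≤1 | yes b≤1 = square≤-permutation k+1≡q a≤1 b≤1
    ... | no a≰1  | _       = square≤-tight k+1≡q 1≤m
            (slack-tightˡ (≰⇒> a≰1) (t≤b k+1≡q)) (slack-tightʳ 1≤m (t≤b k+1≡q) (≰⇒> a≰1))
      where
      -- The layer is nonempty, so 2 ≤ a < q and hence q ≥ 3.
      1≤m : 1 ≤ m
      1≤m = s≤s⁻¹ (s≤s⁻¹ (≤-trans (s≤s (≰⇒> a≰1)) (emptyRows<q (1≤k k+1≡q))))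
    ... | yes _   | no b≰1  = square≤-tight k+1≡q 1≤m
            (slack-tightʳ 1≤m (t≤a k+1≡q) (≰⇒> b≰1)) (slack-tightˡ (≰⇒> b≰1) (t≤a k+1≡q))
      where
      1≤m : 1 ≤ m
      1≤m = s≤s⁻¹ (s≤s⁻¹ (≤-trans (s≤s (≰⇒> b≰1))
              (ᵀ.emptyRows<q (subst (1 ≤_) (sym kᵀ≡k) (1≤k k+1≡q)))))

-- If the least layer has at least q codewords, so has each of the q layers parallel to it;
-- otherwise it is sparse.
square≤total-of-min : ∀ {m} {f : Cube (2 + m)} → Separating f → (x₀ : Fin (2 + m)) →
  (∀ x → layer f x₀ ≤ layer f x) → (∀ y → layer f x₀ ≤ layer (rot f) y) →
  (∀ z → layer f x₀ ≤ layer (rot (rot f)) z) → (2 + m) * (2 + m) ≤ total f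
square≤total-of-min {m} {f} sep x₀ k≤ k≤rot k≤rotrot with layer f x₀ <? 2 + m
... | yes k<q = SparseLayer.square≤ sep x₀ k≤rot k≤rotrot k<q
... | no k≮q  = subst (_≤ total f) (∑-const (2 + m) (2 + m)) (∑-mono λ x → ≤-trans (≮⇒≥ k≮q) (k≤ x))

square≤total : ∀ {m} {f : Cube (2 + m)} → Separating f → (2 + m) * (2 + m) ≤ total f
square≤total {m} {f} sep with argmin (layer f) | argmin (layer (rot f)) | argmin (layer (rot (rot f)))
... | x , x-min | y , y-min | z , z-min
  with ≤-total (layer f x) (layer (rot f) y) | ≤-total (layer (rot f) y) (layer (rot (rot f)) z)
     | ≤-total (layer f x) (layer (rot (rot f)) z)
... | inj₁ x≤y | _ | inj₁ x≤z = square≤total-of-min sep x x-min (≤-trans x≤y ∘ y-min) (≤-trans x≤z ∘ z-min)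
-- The cube is rotated until the least layer has its first coordinate fixed. Three rotations give
-- back `f` definitionally, so the minimality facts carry over unchanged.
... | inj₂ y≤x | inj₁ y≤z | _ = subst ((2 + m) * (2 + m) ≤_) (total-rot f)
  (square≤total-of-min (rot-separating sep) y y-min (≤-trans y≤z ∘ z-min) (≤-trans y≤x ∘ x-min))
... | inj₁ x≤y | _ | inj₂ z≤x = subst ((2 + m) * (2 + m) ≤_) (trans (total-rot (rot f)) (total-rot f))
  (square≤total-of-min (rot-separating (rot-separating sep)) z z-min (≤-trans z≤x ∘ x-min) (≤-trans (≤-trans z≤x x≤y) ∘ y-min))
... | inj₂ y≤x | inj₂ z≤y | _ = subst ((2 + m) * (2 + m) ≤_) (trans (total-rot (rot f)) (total-rot f))
  (square≤total-of-min (rot-separating (rot-separating sep)) z z-min (≤-trans (≤-trans z≤y y≤x) ∘ x-min) (≤-trans z≤y ∘ y-min))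

-- From codes to cubes

_≟ⱽ_ : DecidableEquality (Vertex (K³ q))
_≟ⱽ_ = ≡-dec _≟ᶠ_ (≡-dec _≟ᶠ_ _≟ᶠ_)

module _ {q : ℕ} where
  open import Data.List.Membership.DecPropositional (_≟ⱽ_ {q}) public using (_∈_; _∈?_)

indicator : Bool → ℕ
indicator b = if b then 1 else 0

incidence : List (Vertex (K³ q)) → Cube q
incidence vs x y z = indicator (does ((x , y , z) ∈? vs))

incidence≤1 : (vs : List (Vertex (K³ q))) → ∀ x y z → incidence vs x y z ≤ 1
incidence≤1 vs x y z with does ((x , y , z) ∈? vs)
... | true  = ≤-refl
... | false = z≤n

incidence≢0⇒∈ : ∀ vs {x y z : Fin q} → incidence vs x y z ≢ 0 → (x , y , z) ∈ vs
incidence≢0⇒∈ vs {x} {y} {z} i≢0 with (x , y , z) ∈? vs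
... | yes v∈ = v∈
... | no _   = contradiction refl i≢0

incidence≡0⇒∉ : ∀ vs {x y z : Fin q} → incidence vs x y z ≡ 0 → ¬ (x , y , z) ∈ vs
incidence≡0⇒∉ vs {x} {y} {z} i≡0 with (x , y , z) ∈? vs
... | yes _ = contradiction i≡0 λ ()
... | no v∉ = v∉

∈⇒incidence≢0 : ∀ vs {x y z : Fin q} → (x , y , z) ∈ vs → incidence vs x y z ≢ 0
∈⇒incidence≢0 vs v∈ i≡0 = incidence≡0⇒∉ vs i≡0 v∈

total-point≤1 : (v : Vertex (K³ q)) → total (λ x y z → indicator (does ((x , y , z) ≟ⱽ v))) ≤ 1
total-point≤1 {q} v@(a , b , c) = begin
  sum (layer δ)                ≤⟨ ∑-single≤ (layer δ) a (λ x x≢a → ∑-zero (sum ∘ δ x) λ y → ∑-zero (δ x y) λ z → off (x , y , z) (x≢a ∘ cong proj₁)) ⟩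
  layer δ a                    ≤⟨ ∑-single≤ (sum ∘ δ a) b (λ y y≢b → ∑-zero (δ a y) λ z → off (a , y , z) (y≢b ∘ cong (proj₁ ∘ proj₂))) ⟩
  sum (δ a b)                  ≤⟨ ∑-single≤ (δ a b) c (λ z z≢c → off (a , b , z) (z≢c ∘ cong (proj₂ ∘ proj₂))) ⟩
  δ a b c                      ≤⟨ indicator≤1 (does ((a , b , c) ≟ⱽ v)) ⟩
  1                            ∎
  where
  open ≤-Reasoning
  δ : Cube q
  δ x y z = indicator (does ((x , y , z) ≟ⱽ v))
  indicator≤1 : ∀ b → indicator b ≤ 1
  indicator≤1 true  = ≤-refl
  indicator≤1 false = z≤n
  off : ∀ u → u ≢ v → indicator (does (u ≟ⱽ v)) ≡ 0
  off u u≢v with u ≟ⱽ v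
  ... | yes u≡v = contradiction u≡v u≢v
  ... | no _    = refl

total-mono : {f g : Cube q} → (∀ x y z → f x y z ≤ g x y z) → total f ≤ total g
total-mono f≤g = ∑-mono λ x → ∑-mono λ y → ∑-mono (f≤g x y)

total-+ : (f g : Cube q) → total (λ x y z → f x y z + g x y z) ≡ total f + total g
total-+ f g = trans
  (sum-cong-≗ λ x → trans (sum-cong-≗ λ y → ∑-distrib-+ (f x y) (g x y)) (∑-distrib-+ (sum ∘ f x) (sum ∘ g x)))
  (∑-distrib-+ (layer f) (layer g))

total-zero : {f : Cube q} → (∀ x y z → f x y z ≡ 0) → total f ≡ 0
total-zero {f = f} f≡0 = ∑-zero (layer f) λ x → ∑-zero (sum ∘ f x) λ y → ∑-zero (f x y) (f≡0 x y)

-- Membership in `v ∷ vs` is decided by a disjunction, whose indicator is at most the sum of the two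
-- indicators, so each entry of the list adds at most 1.
total-incidence≤length : (vs : List (Vertex (K³ q))) → total (incidence vs) ≤ length vs
total-incidence≤length {q} []       = ≤-reflexive (total-zero {f = incidence {q} []} λ _ _ _ → refl)
total-incidence≤length {q} (v ∷ vs) = begin
  total (incidence (v ∷ vs))                   ≤⟨ total-mono (λ x y z → ∨≤+ (does ((x , y , z) ≟ⱽ v)) (does ((x , y , z) ∈? vs))) ⟩
  total (λ x y z → δ x y z + incidence vs x y z) ≡⟨ total-+ δ (incidence vs) ⟩
  total δ + total (incidence vs)               ≤⟨ +-mono-≤ (total-point≤1 v) (total-incidence≤length vs) ⟩
  1 + length vs                                ∎
  where
  open ≤-Reasoning
  δ : Cube q
  δ x y z = indicator (does ((x , y , z) ≟ⱽ v))
  ∨≤+ : ∀ b c → indicator (b ∨ c) ≤ indicator b + indicator c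
  ∨≤+ true  c = s≤s z≤n
  ∨≤+ false c = ≤-refl

-- For distinct non-codewords, solid location yields a codeword near the first but not the second.
-- It lies on one of the three lines through the first, and the hypothesis on that line puts it near
-- the second.
incidence-separating : (C : Code (K³ q)) → SolidLocatingDominating (K³ q) C →
                       Separating (incidence (Code.codewords C))
incidence-separating {q} C sld = record
  { bounded   = incidence≤1 codewords
  ; separated = separated
  }
  where
  open Code C
  f = incidence codewords
  separated : ∀ {x y z p r s} → f x y z ≡ 0 → f p r s ≡ 0 →
              (∀ a → f a y z ≢ 0 → Near p r s a y z) →
              (∀ b → f x b z ≢ 0 → Near p r s x b z) →
              (∀ c → f x y c ≢ 0 → Near p r s x y c) →
              p ≡ x × r ≡ y × s ≡ z
  separated {x} {y} {z} {p} {r} {s} u∉ v∉ hx hy hz with (x , y , z) ≟ⱽ (p , r , s)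
  ... | yes refl = refl , refl , refl
  ... | no u≢v with sld _ _ (incidence≡0⇒∉ codewords u∉) (incidence≡0⇒∉ codewords v∉) u≢v
  ... | (a , b , c) , (near , w∈C) , w∉Iv = contradiction (Near⇒N (near-v (N⇒Near near) (∈⇒incidence≢0 codewords w∈C)) , w∈C) w∉Iv
    where
    near-v : Near x y z a b c → f a b c ≢ 0 → Near p r s a b c
    near-v (inj₁ (refl , refl))        = hx a
    near-v (inj₂ (inj₁ (refl , refl))) = hy b
    near-v (inj₂ (inj₂ (refl , refl))) = hz c

theorem23 : ∀ (q : ℕ) → 2 ≤ q → Isγᴰᴸᴰ (K³ q) (q ^ 2)
theorem23 (suc (suc m)) (s≤s (s≤s _)) =
  (latinCode , latinCode-solid {1 + m} , latinCode-size {1 + m}) ,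
  λ C sld → begin
    (2 + m) ^ 2                             ≡⟨ cong ((2 + m) *_) (*-identityʳ (2 + m)) ⟩
    (2 + m) * (2 + m)                             ≤⟨ square≤total (incidence-separating C sld) ⟩
    total (incidence (Code.codewords C))   ≤⟨ total-incidence≤length (Code.codewords C) ⟩
    Code.size C                            ∎
  where
  open ≤-Reasoning
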